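{- Let $n$ be an integer with $n\geq 11$. (i) If $n\leq 37$: if $n\equiv 8\pmod{11}$ then $\gamma^{ID}(C_n(1,3)) = \lceil 4n/11\rceil+1$, and otherwise $\gamma^{ID}(C_n(1,3)) = \lceil 4n/11\rceil$. (ii) If $n \geq 38$: if $n\equiv 2,5,8\pmod{11}$ then $\gamma^{ID}(C_n(1,3)) = \lceil 4n/11\rceil+1$, and otherwise $\gamma^{ID}(C_n(1,3)) = \lceil 4n/11\rceil$.
   Context: For a positive integer $n$, the circulant graph $C_n(1,3)$ has vertex set $\mathbb{Z}_n$, and $u$ is adjacent to $u\pm1$ and $u\pm 3$ (modulo $n$); $N[u]=\{u,u\pm1,u\pm3\}$. For a code (nonempty subset) $C\subseteq\mathbb{Z}_n$, $I(C;u)=N[u]\cap C$. $C$ is identifying if $I(C;u)\neq\emptyset$ for all $u$ and $I(C;u)\ne I(C;v)$ for all distinct $u,v$. $\gamma^{ID}(G)$ is the minimum cardinality of an identifying code in $G$. -}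

module Defs where

open import Data.Nat using (ℕ; suc; _+_; _*_; _≤_; _%_; _/_; NonZero)
open import Data.Fin using (Fin; toℕ)
open import Data.Fin.Subset using (Subset; _∩_; Nonempty; ∣_∣)
open import Data.Vec using (tabulate)
open import Data.Bool using (Bool; true; false; _∨_)
open import Data.Nat using (_≡ᵇ_)
open import Data.Product using (_×_; Σ)
open import Relation.Binary.PropositionalEquality using (_≡_; _≢_)

shiftEq : (n : ℕ) → .{{NonZero n}} → ℕ → ℕ → ℕ → Bool
shiftEq n a d b = ((a + d) % n) ≡ᵇ (b % n)

closedAdj : (n : ℕ) → .{{NonZero n}} → Fin n → Fin n → Bool
closedAdj n u v =
  shiftEq n (toℕ u) 0 (toℕ v) ∨
  shiftEq n (toℕ u) 1 (toℕ v) ∨ shiftEq n (toℕ v) 1 (toℕ u) ∨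
  shiftEq n (toℕ u) 3 (toℕ v) ∨ shiftEq n (toℕ v) 3 (toℕ u)

N[_] : {n : ℕ} → .{{NonZero n}} → Fin n → Subset n
N[_] {n} u = tabulate (λ v → closedAdj n u v)

I : {n : ℕ} → .{{NonZero n}} → Subset n → Fin n → Subset n
I C u = N[ u ] ∩ C

-- identifying code in C_n(1,3) (nonemptiness of C follows from the first condition)
IsIdentifying : (n : ℕ) → .{{NonZero n}} → Subset n → Set
IsIdentifying n C =
  ((u : Fin n) → Nonempty (I C u)) ×
  ((u v : Fin n) → u ≢ v → I C u ≢ I C v)

γID≡ : (n : ℕ) → .{{NonZero n}} → ℕ → Set
γID≡ n m =
  Σ (Subset n) (λ C → IsIdentifying n C × ∣ C ∣ ≡ m) ×
  ((C : Subset n) → IsIdentifying n C → m ≤ ∣ C ∣)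

ceil4n/11 : ℕ → ℕ
ceil4n/11 n = (4 * n + 10) / 11

{-# OPTIONS --safe #-}

-- Lift C to an n-periodic binary sequence. Being identifying is a condition on
-- windows of length 13, so the sequence is a closed walk in the graph of windows
-- of length 12. A potential θ on that graph shows that 154 ∣ C ∣ - 56 n = 14 (11 ∣ C ∣ - 4 n)
-- is a sum of nonnegative step costs: steps along the cycle of the 11-periodic
-- code 11001100000 cost 0, a step leaving that cycle costs at least 43, and steps
-- off the cycle cost at least 1. Hence c = 11 ∣ C ∣ - 4 n is 0 (the walk stays on
-- the cycle), at least 4 (it leaves the cycle), or satisfies n ≤ 14 c (it avoids
-- the cycle). The values c = 1, 2, 3 occur for ∣ C ∣ = ⌈4n/11⌉ exactly when
-- n ≡ 8, 5, 2 (mod 11), and then n ≤ 14, 28, 42. Optimal codes repeat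
-- 11001100000 and append at most ten letters, apart from a few sporadic n.
module Submission where

open import Defs
open import Data.Bool as Bool using (Bool; true; false; not; T; T?; _∧_; _∨_; _xor_; if_then_else_)
open import Data.Bool.ListAction using (all)
open import Data.Bool.Properties using (T-∧; T-∨; T-≡)
open import Data.Empty using (⊥)
open import Data.Fin as Fin using (Fin; toℕ)
open import Data.Fin.Properties using (all?; toℕ-fromℕ<; toℕ<n; toℕ-injective)
open import Data.Fin.Subset using (Subset; Nonempty; _∈_; _⊆_; ∣_∣)
open import Data.Fin.Subset.Properties using (⊆-antisym; nonempty?)
open import Data.List using (List; []; _∷_; _++_; length; take; drop; upTo)
open import Data.List.Relation.Unary.All.Properties using (all⁺; all⁻; applyUpTo⁺₁; applyUpTo⁻)
open import Data.Maybe using (Maybe; just; nothing; is-just; maybe; fromMaybe)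
open import Data.Nat
open import Data.Nat.Divisibility using (n∣m*n)
open import Data.Nat.DivMod
open import Data.Nat.GeneralisedArithmetic using (iterate)
open import Data.Nat.Properties
open import Data.Nat.Tactic.RingSolver using (solve-∀)
open import Data.Product
open import Data.Sum using (_⊎_; inj₁; inj₂)
open import Data.Unit using (tt)
open import Data.Vec as Vec using (Vec; []; _∷_; fromList)
open import Data.Vec.Properties using (≡-dec; lookup-zipWith; lookup∘tabulate; []=⇒lookup; lookup⇒[]=)
open import Function
open import Function.Bundles using (module Equivalence)
open import Relation.Binary.Definitions using (tri<; tri≈; tri>)
open import Relation.Binary.PropositionalEquality
open import Relation.Nullary
open import Relation.Nullary.Decidable using (decidable-stable; toWitness; True; _×-dec_; _⊎-dec_; _→-dec_; ¬?)

open Equivalence using (to; from)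

private variable
  k : ℕ

pattern ■ = true
pattern □ = false

-- Binary words and the window condition.

bit : Bool → ℕ
bit b = if b then 1 else 0

window : ∀ k → (ℕ → Bool) → Vec Bool k
window zero    x = []
window (suc k) x = x 0 ∷ window k (x ∘ suc)

window-cong : ∀ k {x y : ℕ → Bool} → (∀ i → i < k → x i ≡ y i) → window k x ≡ window k y
window-cong zero    x≗y = refl
window-cong (suc k) x≗y = cong₂ _∷_ (x≗y 0 z<s) (window-cong k (λ i i<k → x≗y (suc i) (s<s i<k)))

front : Vec Bool (suc k) → Vec Bool k
front {zero}  _       = []
front {suc k} (b ∷ w) = b ∷ front w

front-window : ∀ k x → front (window (suc k) x) ≡ window k x
front-window zero    x = refl
front-window (suc k) x = cong (x 0 ∷_) (front-window k (x ∘ suc))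

-- The offsets of N[ u ], counted from u - 3.
ball : ℕ → Bool
ball 0 = true
ball 2 = true
ball 3 = true
ball 4 = true
ball 6 = true
ball _ = false

shift : ℕ → (ℕ → Bool) → ℕ → Bool
shift zero    m j       = m j
shift (suc d) m zero    = false
shift (suc d) m (suc j) = shift d m j

-- A code must meet mask 0 to cover u, and mask d to separate u from u + d.
mask : ℕ → ℕ → Bool
mask zero    j = ball j
mask (suc d) j = ball j xor shift (suc d) ball j

meets : Vec Bool k → (ℕ → Bool) → Bool
meets []      m = false
meets (b ∷ w) m = (b ∧ m 0) ∨ meets w (m ∘ suc)

-- Placements at o > 0 follow from o = 0 in later windows; they are included because
-- states of 12 letters carry no valid potential without them.
valid : Vec Bool 13 → Bool
valid w = all (λ o → all (λ d → meets w (shift o (mask d))) (upTo (7 ∸ o))) (upTo 7)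

shift⁺ : ∀ d {m} j → T (m j) → T (shift d m (d + j))
shift⁺ zero    j t = t
shift⁺ (suc d) j t = shift⁺ d j t

shift⁻ : ∀ d {m} j → T (shift d m j) → ∃ λ i → j ≡ d + i × T (m i)
shift⁻ zero    j       t = j , refl , t
shift⁻ (suc d) (suc j) t = map₂ (map₁ (cong suc)) (shift⁻ d j t)

ball<7 : ∀ j → T (ball j) → j < 7
ball<7 0 _ = z<s
ball<7 2 _ = s≤s (s≤s (s≤s z≤n))
ball<7 3 _ = s≤s (s≤s (s≤s (s≤s z≤n)))
ball<7 4 _ = s≤s (s≤s (s≤s (s≤s (s≤s z≤n))))
ball<7 6 _ = ≤-refl

T-xor⁺ : ∀ {a b} → (T a → ¬ T b) → (¬ T a → T b) → T (a xor b)
T-xor⁺ {true}  {true}  f g = f tt tt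
T-xor⁺ {true}  {false} f g = tt
T-xor⁺ {false} {true}  f g = tt
T-xor⁺ {false} {false} f g = g id

T-xor⁻ : ∀ {a b} → T (a xor b) → (T a × ¬ T b) ⊎ (¬ T a × T b)
T-xor⁻ {true}  {false} _ = inj₁ (tt , id)
T-xor⁻ {false} {true}  _ = inj₂ (id , tt)

mask<7+d : ∀ d j → T (mask d j) → j < 7 + d
mask<7+d zero    j t = ball<7 j t
mask<7+d (suc d) j t with T-xor⁻ t
... | inj₁ (b , _) = ≤-trans (ball<7 j b) (m≤m+n 7 (suc d))
... | inj₂ (_ , b) with shift⁻ (suc d) j b
...   | i , refl , bi = subst (suc d + i <_) (+-comm (suc d) 7) (+-monoʳ-< (suc d) (ball<7 i bi))

meets⁺ : ∀ k (x m : ℕ → Bool) j → j < k → T (x j) → T (m j) → T (meets (window k x) m)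
meets⁺ (suc k) x m zero    _   xj mj = from T-∨ (inj₁ (from T-∧ (xj , mj)))
meets⁺ (suc k) x m (suc j) j<k xj mj = from T-∨ (inj₂ (meets⁺ k (x ∘ suc) (m ∘ suc) j (s<s⁻¹ j<k) xj mj))

meets⁻ : ∀ k (x m : ℕ → Bool) → T (meets (window k x) m) → ∃ λ j → j < k × T (x j) × T (m j)
meets⁻ (suc k) x m t with to T-∨ t
... | inj₁ t₀ = let x₀ , m₀ = to T-∧ t₀ in 0 , z<s , x₀ , m₀
... | inj₂ t₁ = let j , j<k , xj , mj = meets⁻ k (x ∘ suc) (m ∘ suc) t₁ in suc j , s<s j<k , xj , mj

all-upTo⁺ : ∀ p n → (∀ i → i < n → T (p i)) → T (all p (upTo n))
all-upTo⁺ p n f = all⁻ p (applyUpTo⁺₁ id n (f _))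

all-upTo⁻ : ∀ p n → T (all p (upTo n)) → ∀ i → i < n → T (p i)
all-upTo⁻ p n t i = applyUpTo⁻ id n (all⁺ p _ t)

Hits : (ℕ → Bool) → ℕ → ℕ → Set
Hits x s d = ∃ λ j → T (x (s + j)) × T (mask d j)

-- A record, so that the type checker does not unfold valid when comparing types.
record ValidAt (x : ℕ → Bool) (s : ℕ) : Set where
  constructor validAt
  field
    isValid : T (valid (window 13 (λ i → x (s + i))))

open ValidAt

-- Mask `d` placed at `o` reaches offsets below `o + 7 + d`, which is at most 13 because
-- `d + o ≤ 6`. So every required hit already lies inside the window.
hits⇒valid : ∀ x → (∀ s d → d < 7 → Hits x s d) → ∀ s → ValidAt x s
hits⇒valid x hits s = validAt (
  all-upTo⁺ _ 7 λ o o<7 → all-upTo⁺ (λ d → meets (window 13 (λ i → x (s + i))) (shift o (mask d))) (7 ∸ o) λ d d<7∸o →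
  let d+o<7 = m≤o∸n⇒m+n≤o (suc d) (<⇒≤ o<7) d<7∸o
      j , xj , mj = hits (s + o) d (≤-trans (s≤s (m≤m+n d o)) d+o<7)
  in meets⁺ 13 (λ i → x (s + i)) (shift o (mask d)) (o + j) (bound o d j d+o<7 (mask<7+d d j mj))
       (subst (λ i → T (x i)) (+-assoc s o j) xj) (shift⁺ o {mask d} j mj))
  where
  bound : ∀ o d j → suc d + o ≤ 7 → j < 7 + d → o + j < 13
  bound o d j d+o<7 j<7+d = s≤s⁻¹ (begin
    suc (suc (o + j)) ≡⟨ cong suc (+-suc o j) ⟨
    suc (o + suc j)   ≤⟨ s≤s (+-monoʳ-≤ o j<7+d) ⟩
    suc (o + (7 + d)) ≡⟨ cong suc (+-comm o (7 + d)) ⟩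
    suc (7 + d + o)   ≤⟨ +-monoʳ-≤ 7 d+o<7 ⟩
    14                ∎)
    where open ≤-Reasoning

valid⇒hits : ∀ x s → ValidAt x s →
             ∀ d → d < 7 → ∃ λ j → j < 13 × T (x (s + j)) × T (mask d j)
valid⇒hits x s v d d<7 =
  meets⁻ 13 (λ i → x (s + i)) (mask d) (all-upTo⁻ (λ d → meets w (mask d)) 7
    (all-upTo⁻ (λ o → all (λ d → meets w (shift o (mask d))) (upTo (7 ∸ o))) 7 (isValid v) 0 z<s) d d<7)
  where w = window 13 (λ i → x (s + i))

-- The potential on the graph of windows and its verification.

everyWord : ∀ k → (Vec Bool k → Bool) → Bool
everyWord zero    p = p []
everyWord (suc k) p = everyWord k (p ∘ (false ∷_)) ∧ everyWord k (p ∘ (true ∷_))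

everyWord-sound : ∀ k (p : Vec Bool k → Bool) → T (everyWord k p) → ∀ w → T (p w)
everyWord-sound zero    p t []          = t
everyWord-sound (suc k) p t (false ∷ w) = everyWord-sound k _ (proj₁ (to T-∧ t)) w
everyWord-sound (suc k) p t (true  ∷ w) =
  everyWord-sound k _ (proj₂ (to (T-∧ {everyWord k (p ∘ (false ∷_))}) t)) w

-- A partial function on words. `none` at any height prunes a whole subtree, so the value iteration
-- does not visit invalid words one by one.
data Trie : ℕ → Set where
  none : Trie k
  leaf : ℕ → Trie 0
  node : Trie k → Trie k → Trie (suc k)

lookup : Trie k → Vec Bool k → Maybe ℕ
lookup none       w           = nothing
lookup (leaf a)   []          = just a
lookup (node l r) (false ∷ w) = lookup l w
lookup (node l r) (true  ∷ w) = lookup r w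

branch : Trie k → Trie k → Trie (suc k)
branch none none = none
branch l    r    = node l r

build : ∀ k → (Vec Bool k → Maybe ℕ) → Trie k
build zero    f = maybe leaf none (f [])
build (suc k) f = branch (build k (f ∘ (false ∷_))) (build k (f ∘ (true ∷_)))

override : Trie k → Trie k → Trie k
override none       u            = u
override t          none         = t
override (leaf a)   (leaf b)     = leaf a
override (node l r) (node l′ r′) = node (override l l′) (override r r′)

restrict : Trie 0 → Trie 0 → Trie 0
restrict none     u = none
restrict (leaf _) u = u

minimum : Trie 0 → Trie 0 → Trie 0
minimum none     u        = u
minimum t        none     = t
minimum (leaf a) (leaf b) = leaf (a ⊓′ b)

mapLeaf : (ℕ → ℕ) → Trie 0 → Trie 0
mapLeaf f none     = none
mapLeaf f (leaf a) = leaf (f a)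

-- Consecutive states overlap in `k` letters. The recursion descends through these and then
-- minimises over the last letter, the only part of the next state that the current one does not
-- determine.
cheapest : (ℕ → ℕ) → Trie (suc k) → Trie (suc k) → Trie k
cheapest {zero}  f (node e e′) (node t t′) = mapLeaf f (minimum (restrict e t) (restrict e′ t′))
cheapest {suc k} f (node e e′) (node t t′) = branch (cheapest f e t) (cheapest f e′ t′)
cheapest         f _           _           = none

-- One round of value iteration: a step paying for the letter b costs 154 b - 57,
-- that is, 14 (11 b - 4) less the amount 1 charged off the cycle.
relax : Trie (suc (suc k)) → Trie (suc k) → Trie (suc k)
relax (node e e′) t = node (cheapest (_∸ 57) e t) (cheapest (_+ 97) e′ t)
relax _           t = none

period : List Bool
period = ■ ∷ ■ ∷ □ ∷ □ ∷ ■ ∷ ■ ∷ □ ∷ □ ∷ □ ∷ □ ∷ □ ∷ []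

nth : List Bool → ℕ → Bool
nth []      _       = false
nth (b ∷ l) zero    = b
nth (b ∷ l) (suc i) = nth l i

-- Following the cycle, the potential decreases by 154 b - 56; the start 280 keeps
-- it in ℕ.
cyclePotential : Vec Bool 12 → Maybe ℕ
cyclePotential = search 11 (λ i → nth period (i % 11)) 280
  where
  search : ℕ → (ℕ → Bool) → ℕ → Vec Bool 12 → Maybe ℕ
  search zero    x v w = nothing
  search (suc i) x v w =
    if does (≡-dec Bool._≟_ (window 12 x) w) then just v
    else search i (x ∘ suc) (v + 56 ∸ 154 * bit (x 0)) w

onCycle : Vec Bool 12 → Bool
onCycle w = is-just (cyclePotential w)

-- The cheapest way to the cycle. The initial 10000 stands for infinity, and 30
-- rounds reach the fixed point.
potential : Trie 12
potential = run (build 12 cyclePotential) (build 13 (λ w → if valid w then just 0 else nothing))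
  where
  run : Trie 12 → Trie 13 → Trie 12
  run z e = iterate (λ t → override z (relax e t)) (override z (build 12 (λ _ → just 10000))) 30

-- The constant is 43 = 14 * 3 + 1: an excess of `14 * c` with `c ≤ 3` is at most 42 and cannot pay
-- for leaving the cycle.
slackOK : Bool → Bool → ℕ → ℕ → Bool
slackOK true  true  p c = p ≡ᵇ c
slackOK true  false p c = p + 43 ≤ᵇ c
slackOK false _     p c = p + 1 ≤ᵇ c

stepOK : (Vec Bool 12 → ℕ) → Vec Bool 13 → Bool
stepOK θ w = slackOK (onCycle (front w)) (onCycle (Vec.tail w))
               (56 + θ (front w)) (154 * bit (Vec.head w) + θ (Vec.tail w))

Certifies : (Vec Bool 12 → ℕ) → Set
Certifies θ = ∀ w → T (valid w) → T (stepOK θ w)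

-- Words missing from the trie get `0`. `check` tests the resulting total function, so the
-- certificate covers this default too.
value : Trie 12 → Vec Bool 12 → ℕ
value t w = fromMaybe 0 (lookup t w)

required : (Vec Bool 12 → ℕ) → Vec Bool 13 → Bool
required θ w = not (valid w) ∨ stepOK θ w

-- The trie is an argument so that evaluation shares it between all words.
check : Trie 12 → Bool
check t = everyWord 13 (required (value t))

check-sound : ∀ t → check t ≡ true → Certifies (value t)
check-sound t eq w v = modus (valid w) v (everyWord-sound 13 (required (value t)) (subst T (sym eq) tt) w)
  where
  modus : ∀ a {b} → T a → T (not a ∨ b) → T b
  modus true _ t = t

abstract
  -- Soundness rests on the exhaustive test of all words of length 13 alone: neither convergence of
  -- the iteration nor the truncation in `_∸ 57` has to be justified.
  certificate : Σ (Vec Bool 12 → ℕ) Certifies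
  certificate = value potential , check-sound potential refl

-- Arithmetic modulo `n` and neighbourhoods in the circulant graph.

private
  T-∨₅⁻ : ∀ {a b c d e} → T (a ∨ b ∨ c ∨ d ∨ e) → T a ⊎ T b ⊎ T c ⊎ T d ⊎ T e
  T-∨₅⁻ {true}                                     _ = inj₁ tt
  T-∨₅⁻ {false} {true}                             _ = inj₂ (inj₁ tt)
  T-∨₅⁻ {false} {false} {true}                     _ = inj₂ (inj₂ (inj₁ tt))
  T-∨₅⁻ {false} {false} {false} {true}             _ = inj₂ (inj₂ (inj₂ (inj₁ tt)))
  T-∨₅⁻ {false} {false} {false} {false} {true}     _ = inj₂ (inj₂ (inj₂ (inj₂ tt)))

  T-∨₅⁺ : ∀ {a b c d e} → T a ⊎ T b ⊎ T c ⊎ T d ⊎ T e → T (a ∨ b ∨ c ∨ d ∨ e)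
  T-∨₅⁺ {true}                              _ = tt
  T-∨₅⁺ {false} {true}                      _ = tt
  T-∨₅⁺ {false} {false} {true}              _ = tt
  T-∨₅⁺ {false} {false} {false} {true}      _ = tt
  T-∨₅⁺ {false} {false} {false} {false} {true}  _ = tt
  T-∨₅⁺ {false} {false} {false} {false} {false} (inj₂ (inj₂ (inj₂ (inj₂ ()))))

module Cyclic (n : ℕ) .{{_ : NonZero n}} where

  _≋_ : ℕ → ℕ → Set
  a ≋ b = a % n ≡ b % n

  infix 4 _≋_

  ≋-+ʳ : ∀ {a b} c → a ≋ b → a + c ≋ b + c
  ≋-+ʳ {a} {b} c a≋b = begin
    (a + c) % n         ≡⟨ %-distribˡ-+ a c n ⟩
    (a % n + c % n) % n ≡⟨ cong (λ r → (r + c % n) % n) a≋b ⟩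
    (b % n + c % n) % n ≡⟨ %-distribˡ-+ b c n ⟨
    (b + c) % n         ∎
    where open ≡-Reasoning

  ≋-cancelʳ : ∀ {a b} c → a + c ≋ b + c → a ≋ b
  ≋-cancelʳ {a} {b} c a+c≋b+c = begin
    a % n                       ≡⟨ pad a ⟨
    (a + c + (c * n ∸ c)) % n   ≡⟨ ≋-+ʳ (c * n ∸ c) a+c≋b+c ⟩
    (b + c + (c * n ∸ c)) % n   ≡⟨ pad b ⟩
    b % n                       ∎
    where
    open ≡-Reasoning
    -- `c * n ∸ c` serves as the negative of `c`: together they make the multiple `c * n`.
    pad : ∀ e → (e + c + (c * n ∸ c)) % n ≡ e % n
    pad e = begin
      (e + c + (c * n ∸ c)) % n   ≡⟨ cong (_% n) (+-assoc e c _) ⟩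
      (e + (c + (c * n ∸ c))) % n ≡⟨ cong (λ r → (e + r) % n) (m+[n∸m]≡n (m≤m*n c n)) ⟩
      (e + c * n) % n             ≡⟨ [m+kn]%n≡m%n e c n ⟩
      e % n                       ∎

  ≋-swapʳ : ∀ a b c → a + b + c ≋ a + c + b
  ≋-swapʳ a b c = cong (_% n) (trans (+-assoc a b c) (trans (cong (a +_) (+-comm b c)) (sym (+-assoc a c b))))

  ≋⇒≡ : ∀ {a b} → a < n → b < n → a ≋ b → a ≡ b
  ≋⇒≡ a<n b<n a≋b = trans (sym (m<n⇒m%n≡m a<n)) (trans a≋b (m<n⇒m%n≡m b<n))

  mod-≋ : ∀ i → toℕ (i mod n) ≋ i
  mod-≋ i = trans (cong (_% n) (toℕ-fromℕ< (m%n<n i n))) (m%n%n≡m%n i n)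

  mod-≡ : ∀ i (u : Fin n) → i ≋ toℕ u → i mod n ≡ u
  mod-≡ i u i≋u = toℕ-injective (≋⇒≡ (toℕ<n _) (toℕ<n u) (trans (mod-≋ i) i≋u))

  -- The offset j of v counts from u - 3, as in ball.
  Near : Fin n → Fin n → Set
  Near u v = ∃ λ j → T (ball j) × toℕ u + j ≋ toℕ v + 3

  private
    shiftEq⁻ : ∀ a d b → T (shiftEq n a d b) → a + d ≋ b
    shiftEq⁻ a d b = ≡ᵇ⇒≡ _ _

    shiftEq⁺ : ∀ a d b → a + d ≋ b → T (shiftEq n a d b)
    shiftEq⁺ a d b = ≡⇒≡ᵇ _ _

    Link : Fin n → Fin n → Set
    Link u v = let U = toℕ u ; V = toℕ v in
      T (shiftEq n U 0 V) ⊎ T (shiftEq n U 1 V) ⊎ T (shiftEq n V 1 U) ⊎ T (shiftEq n U 3 V) ⊎ T (shiftEq n V 3 U)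

    move : ∀ {a b} c d → a + c ≋ b → a + (c + d) ≋ b + d
    move {a} c d e = trans (cong (_% n) (sym (+-assoc a c d))) (≋-+ʳ d e)

    unmove : ∀ {a b} c d → a + (c + d) ≋ b + d → a + c ≋ b
    unmove {a} c d e = ≋-cancelʳ d (trans (cong (_% n) (+-assoc a c d)) e)

  closedAdj⇒Near : ∀ u v → T (closedAdj n u v) → Near u v
  closedAdj⇒Near u v t = pick (T-∨₅⁻ {shiftEq n U 0 V} t)
    where
    U = toℕ u
    V = toℕ v
    pick : Link u v → Near u v
    pick (inj₁ e)                      = 3 , tt , move 0 3 (shiftEq⁻ U 0 V e)
    pick (inj₂ (inj₁ e))               = 4 , tt , move 1 3 (shiftEq⁻ U 1 V e)
    pick (inj₂ (inj₂ (inj₁ e)))        = 2 , tt , sym (move 1 2 (shiftEq⁻ V 1 U e))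
    pick (inj₂ (inj₂ (inj₂ (inj₁ e)))) = 6 , tt , move 3 3 (shiftEq⁻ U 3 V e)
    pick (inj₂ (inj₂ (inj₂ (inj₂ e)))) = 0 , tt , sym (move 3 0 (shiftEq⁻ V 3 U e))

  Near⇒closedAdj : ∀ u v → Near u v → T (closedAdj n u v)
  Near⇒closedAdj u v (j , b , e) = T-∨₅⁺ {shiftEq n U 0 V} (go j b e)
    where
    U = toℕ u
    V = toℕ v
    go : ∀ j → T (ball j) → U + j ≋ V + 3 → Link u v
    go 3 _ e = inj₁ (shiftEq⁺ U 0 V (unmove 0 3 e))
    go 4 _ e = inj₂ (inj₁ (shiftEq⁺ U 1 V (unmove 1 3 e)))
    go 2 _ e = inj₂ (inj₂ (inj₁ (shiftEq⁺ V 1 U (unmove 1 2 (sym e)))))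
    go 6 _ e = inj₂ (inj₂ (inj₂ (inj₁ (shiftEq⁺ U 3 V (unmove 3 3 e)))))
    go 0 _ e = inj₂ (inj₂ (inj₂ (inj₂ (shiftEq⁺ V 3 U (unmove 3 0 (sym e))))))

  lift : Subset n → ℕ → Bool
  lift C i = Vec.lookup C (i mod n)

  lift-+n : ∀ C i → lift C (n + i) ≡ lift C i
  lift-+n C i = cong (Vec.lookup C) (mod-≡ (n + i) (i mod n)
    (trans (trans (cong (_% n) (+-comm n i)) ([m+n]%n≡m%n i n)) (sym (mod-≋ i))))

  private
    lookup-I : ∀ C u v → Vec.lookup (I C u) v ≡ closedAdj n u v ∧ Vec.lookup C v
    lookup-I C u v = trans (lookup-zipWith _∧_ v N[ u ] C) (cong (_∧ Vec.lookup C v) (lookup∘tabulate (closedAdj n u) v))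

  ∈I⁺ : ∀ C {u v} → Near u v → T (Vec.lookup C v) → v ∈ I C u
  ∈I⁺ C {u} {v} nr c = lookup⇒[]= v (I C u) (trans (lookup-I C u v)
    (to T-≡ (from (T-∧ {closedAdj n u v}) (Near⇒closedAdj u v nr , c))))

  ∈I⁻ : ∀ C {u v} → v ∈ I C u → Near u v × T (Vec.lookup C v)
  ∈I⁻ C {u} {v} v∈ = map₁ (closedAdj⇒Near u v)
    (to T-∧ (subst T (lookup-I C u v) (from T-≡ ([]=⇒lookup v∈))))

  -- Identifying codes and valid windows.

  module Necessary (11≤n : 11 ≤ n) (C : Subset n) (identifying : IsIdentifying n C) where

    private
      x = lift C

      covered : ∀ s → Hits x s 0
      -- The ball of the vertex `s + 3` begins at `s`.
      covered s = let v , v∈ = proj₁ identifying ((s + 3) mod n)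
                      (j , b , e) , c = ∈I⁻ C v∈
                  in j , subst (T ∘ Vec.lookup C) (sym (mod-≡ (s + j) v (≋-cancelʳ 3 (begin
                           (s + j + 3) % n              ≡⟨ ≋-swapʳ s j 3 ⟩
                           (s + 3 + j) % n              ≡⟨ ≋-+ʳ j (mod-≋ (s + 3)) ⟨
                           (toℕ ((s + 3) mod n) + j) % n ≡⟨ e ⟩
                           (toℕ v + 3) % n ∎)))) c
                       , b
        where open ≡-Reasoning

      -- With no codeword in the symmetric difference of the two balls, `I C u` and `I C v` would
      -- contain each other. The double negation is removed by a search bounded by the support of
      -- the mask. The argument works even if offsets coincide modulo `n`, so `11 ≤ n` suffices
      -- here.
      separated : ∀ s d → suc d < 7 → Hits x s (suc d)
      separated s d d<7 = decidable-stable hit? λ ¬hit →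
        proj₂ identifying u v u≢v (⊆-antisym (u⊆v ¬hit) (v⊆u ¬hit))
        where
        open ≡-Reasoning
        D = suc d
        u = (s + 3) mod n
        v = (s + 3 + D) mod n

        hit? : Dec (Hits x s D)
        hit? with anyUpTo? (λ j → T? (x (s + j)) ×-dec T? (mask D j)) (7 + D)
        ... | yes (j , _ , h) = yes (j , h)
        ... | no ¬h = no λ (j , xj , mj) → ¬h (j , mask<7+d D j mj , xj , mj)

        u≢v : u ≢ v
        u≢v u≡v = 0≢1+n (≋⇒≡ (≤-trans (s≤s z≤n) 11≤n) (≤-trans d<7 (≤-trans (m≤m+n 7 4) 11≤n)) (≋-cancelʳ (s + 3) (begin
          (s + 3) % n ≡⟨ mod-≋ (s + 3) ⟨
          toℕ u % n ≡⟨ cong (λ w → toℕ w % n) u≡v ⟩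
          toℕ v % n ≡⟨ mod-≋ (s + 3 + D) ⟩
          (s + 3 + D) % n ≡⟨ cong (_% n) (+-comm (s + 3) D) ⟩
          (D + (s + 3)) % n ∎)))

        u⊆v : ¬ Hits x s D → I C u ⊆ I C v
        u⊆v ¬hit {w} w∈ with ∈I⁻ C w∈
        ... | (j , b , e) , c with T? (shift D ball j)
        ...   | no ¬sh = contradiction (j , subst (T ∘ Vec.lookup C) (sym (mod-≡ (s + j) w s+j≋w)) c , T-xor⁺ (λ _ → ¬sh) (contradiction b)) ¬hit
          where
          s+j≋w = ≋-cancelʳ 3 (begin
            (s + j + 3) % n ≡⟨ ≋-swapʳ s j 3 ⟩
            (s + 3 + j) % n ≡⟨ ≋-+ʳ j (mod-≋ (s + 3)) ⟨
            (toℕ u + j) % n ≡⟨ e ⟩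
            (toℕ w + 3) % n ∎)
        ...   | yes sh with shift⁻ D j sh
        ...     | i , refl , bi = ∈I⁺ C (i , bi , (begin
          (toℕ v + i) % n ≡⟨ ≋-+ʳ i (mod-≋ (s + 3 + D)) ⟩
          (s + 3 + D + i) % n ≡⟨ cong (_% n) (+-assoc (s + 3) D i) ⟩
          (s + 3 + (D + i)) % n ≡⟨ ≋-+ʳ (D + i) (mod-≋ (s + 3)) ⟨
          (toℕ u + (D + i)) % n ≡⟨ e ⟩
          (toℕ w + 3) % n ∎)) c

        v⊆u : ¬ Hits x s D → I C v ⊆ I C u
        v⊆u ¬hit {w} w∈ with ∈I⁻ C w∈
        ... | (i , bi , e) , c = go (T? (ball (D + i)))
          where
          e′ : s + 3 + (D + i) ≋ toℕ w + 3
          e′ = begin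
            (s + 3 + (D + i)) % n ≡⟨ cong (_% n) (+-assoc (s + 3) D i) ⟨
            (s + 3 + D + i) % n ≡⟨ ≋-+ʳ i (mod-≋ (s + 3 + D)) ⟨
            (toℕ v + i) % n ≡⟨ e ⟩
            (toℕ w + 3) % n ∎
          go : Dec (T (ball (D + i))) → w ∈ I C u
          go (yes b) = ∈I⁺ C (D + i , b , trans (≋-+ʳ (D + i) (mod-≋ (s + 3))) e′) c
          go (no ¬b) = contradiction (D + i , subst (T ∘ Vec.lookup C) (sym (mod-≡ (s + (D + i)) w
            (≋-cancelʳ 3 (trans (≋-swapʳ s (D + i) 3) e′)))) c , T-xor⁺ (λ b → contradiction b ¬b) (λ _ → shift⁺ D i bi)) ¬hit

    valid-windows : ∀ s → ValidAt x s
    valid-windows = hits⇒valid x λ where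
      s zero    _   → covered s
      s (suc d) d<7 → separated s d d<7

  module Sufficient (13≤n : 13 ≤ n) (C : Subset n)
                    (valid-windows : ∀ s → ValidAt (lift C) s) where

    private
      hits : ∀ (u : Fin n) d → d < 7 → ∃ λ (v : Fin n) → ∃ λ j →
             j < 13 × T (Vec.lookup C v) × T (mask d j) × toℕ u + j ≋ toℕ v + 3
      hits u d d<7 =
        -- Adding `n ∸ 3` expresses u - 3 modulo `n` without leaving ℕ.
        let s = toℕ u + (n ∸ 3)
            j , j<13 , xj , mj = valid⇒hits (lift C) s (valid-windows s) d d<7
        in (s + j) mod n , j , j<13 , xj , mj , (begin
             (toℕ u + j) % n                 ≡⟨ ≋-+ʳ j (s+3≋u u) ⟨
             (s + 3 + j) % n                 ≡⟨ ≋-swapʳ s 3 j ⟩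
             (s + j + 3) % n                 ≡⟨ ≋-+ʳ 3 (mod-≋ (s + j)) ⟨
             (toℕ ((s + j) mod n) + 3) % n   ∎)
        where
        open ≡-Reasoning
        s+3≋u : ∀ u → toℕ u + (n ∸ 3) + 3 ≋ toℕ u
        s+3≋u u = begin
          (toℕ u + (n ∸ 3) + 3) % n   ≡⟨ cong (_% n) (+-assoc (toℕ u) (n ∸ 3) 3) ⟩
          (toℕ u + (n ∸ 3 + 3)) % n   ≡⟨ cong (λ r → (toℕ u + r) % n) (m∸n+n≡m (≤-trans (m≤m+n 3 10) 13≤n)) ⟩
          (toℕ u + n) % n             ≡⟨ [m+n]%n≡m%n (toℕ u) n ⟩
          toℕ u % n                   ∎

      nonempty : ∀ u → Nonempty (I C u)
      nonempty u = let v , j , _ , c , m , e = hits u 0 z<s in v , ∈I⁺ C (j , m , e) c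

      -- The mask hit is a codeword whose offset from `v` lies in exactly one of the two balls. If
      -- the traces were equal, it would also be reached from the other vertex, necessarily with the
      -- same offset.
      shifted : ∀ u v d → suc d < 7 → toℕ v + suc d ≋ toℕ u → I C u ≢ I C v
      shifted u v d d<7 v+D≋u I≡ =
        let w , j , j<13 , c , m , e = hits v D d<7 in refute w j j<13 c (T-xor⁻ m) e
        where
        D = suc d
        open ≡-Reasoning

        -- This is where `13 ≤ n` enters: the offsets 0 to 12 are distinct modulo `n`, so a vertex
        -- determines its offset.
        offset : ∀ {a b} → a < 13 → b < 13 → toℕ v + a ≋ toℕ v + b → a ≡ b
        offset {a} {b} a<13 b<13 e = ≋⇒≡ (≤-trans a<13 13≤n) (≤-trans b<13 13≤n) (≋-cancelʳ (toℕ v) (begin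
          (a + toℕ v) % n ≡⟨ cong (_% n) (+-comm a (toℕ v)) ⟩
          (toℕ v + a) % n ≡⟨ e ⟩
          (toℕ v + b) % n ≡⟨ cong (_% n) (+-comm (toℕ v) b) ⟩
          (b + toℕ v) % n ∎))

        v+[D+i]≋u+i : ∀ i → toℕ v + (D + i) ≋ toℕ u + i
        v+[D+i]≋u+i i = trans (cong (_% n) (sym (+-assoc (toℕ v) D i))) (≋-+ʳ i v+D≋u)

        refute : ∀ w j → j < 13 → T (Vec.lookup C w) →
                 (T (ball j) × ¬ T (shift D ball j)) ⊎ (¬ T (ball j) × T (shift D ball j)) →
                 toℕ v + j ≋ toℕ w + 3 → ⊥
        refute w j j<13 c (inj₁ (b , ¬sh)) e =
          let (i , bi , u+i≋w) , _ = ∈I⁻ C (subst (w ∈_) (sym I≡) (∈I⁺ C (j , b , e) c))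
              D+i≡j = offset (+-mono-<-≤ d<7 (s≤s⁻¹ (ball<7 i bi))) j<13
                        (trans (v+[D+i]≋u+i i) (trans u+i≋w (sym e)))
          in ¬sh (subst (λ j → T (shift D ball j)) D+i≡j (shift⁺ D {ball} i bi))
        refute w j j<13 c (inj₂ (¬b , sh)) e =
          let i , j≡D+i , bi = shift⁻ D {ball} j sh
              v+j≋u+i = trans (cong (λ j → (toℕ v + j) % n) j≡D+i) (v+[D+i]≋u+i i)
              (k , bk , v+k≋w) , _ = ∈I⁻ C (subst (w ∈_) I≡ (∈I⁺ C (i , bi , trans (sym v+j≋u+i) e) c))
              k≡j = offset (≤-trans (ball<7 k bk) (m≤m+n 7 6)) j<13 (trans v+k≋w (sym e))
          in ¬b (subst (λ j → T (ball j)) k≡j bk)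

      close : ∀ u v {w} j k → j < k → k < 7 → toℕ u + j ≋ w → toℕ v + k ≋ w → I C u ≢ I C v
      close u v {w} j k j<k k<7 u+j≋w v+k≋w = shifted u v d (≤-trans (s≤s (m<k+m)) k<7) (≋-cancelʳ j (begin
        (toℕ v + suc d + j) % n   ≡⟨ cong (_% n) (+-assoc (toℕ v) (suc d) j) ⟩
        (toℕ v + (suc d + j)) % n ≡⟨ cong (λ r → (toℕ v + r) % n) d+j≡k ⟩
        (toℕ v + k) % n           ≡⟨ trans v+k≋w (sym u+j≋w) ⟩
        (toℕ u + j) % n           ∎))
        where
        open ≡-Reasoning
        -- Here `u` is `v` moved by k - j, and `shifted` expects this distance as `suc d`.
        d = k ∸ suc j
        d+j≡k : suc d + j ≡ k
        d+j≡k = trans (sym (+-suc d j)) (m∸n+n≡m j<k)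
        m<k+m : suc d ≤ k
        m<k+m = subst (suc d ≤_) d+j≡k (m≤m+n (suc d) j)

      -- A common element of I C u and I C v puts u and v at distance at most 6.
      separates : ∀ u v → u ≢ v → I C u ≢ I C v
      separates u v u≢v I≡ = apart (proj₁ (∈I⁻ C w∈)) (proj₁ (∈I⁻ C (subst (w ∈_) I≡ w∈)))
        where
        w = proj₁ (nonempty u)
        w∈ = proj₂ (nonempty u)
        apart : Near u w → Near v w → ⊥
        apart (j , bj , ej) (k , bk , ek) with <-cmp j k
        ... | tri< j<k _ _ = close u v j k j<k (ball<7 k bk) ej ek I≡
        ... | tri≈ _ refl _ = u≢v (toℕ-injective (≋⇒≡ (toℕ<n u) (toℕ<n v) (≋-cancelʳ j (trans ej (sym ek)))))
        ... | tri> _ _ k<j = close v u k j k<j (ball<7 j bj) ek ej (sym I≡)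

    identifying : IsIdentifying n C
    identifying = nonempty , separates

-- Lower bound: the total cost of a closed walk.

sumTo : ℕ → (ℕ → ℕ) → ℕ
sumTo zero    f = 0
sumTo (suc n) f = sumTo n f + f n

sumTo-suc : ∀ n f → sumTo (suc n) f ≡ f 0 + sumTo n (f ∘ suc)
sumTo-suc zero    f = sym (+-identityʳ (f 0))
sumTo-suc (suc n) f = trans (cong (_+ f (suc n)) (sumTo-suc n f)) (+-assoc (f 0) _ _)

∣∣≡sumTo : ∀ {n} (C : Subset n) (f : ℕ → Bool) → (∀ i → f (toℕ i) ≡ Vec.lookup C i) →
           ∣ C ∣ ≡ sumTo n (bit ∘ f)
∣∣≡sumTo []      f eq = refl
∣∣≡sumTo {suc n} (b ∷ C) f eq = begin
  ∣ b ∷ C ∣                         ≡⟨ head b ⟩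
  bit b + ∣ C ∣                     ≡⟨ cong₂ _+_ (cong bit (sym (eq Fin.zero))) (∣∣≡sumTo C (f ∘ suc) (eq ∘ Fin.suc)) ⟩
  bit (f 0) + sumTo n (bit ∘ f ∘ suc) ≡⟨ sumTo-suc n (bit ∘ f) ⟨
  sumTo (suc n) (bit ∘ f)           ∎
  where
  open ≡-Reasoning
  head : ∀ b → ∣ b ∷ C ∣ ≡ bit b + ∣ C ∣
  head true  = refl
  head false = refl

-- Summation cancels all intermediate values of `θ`. The two boundary values stay on opposite sides
-- to avoid subtraction; they agree once the walk closes.
telescope : ∀ (a g θ : ℕ → ℕ) → (∀ i → 56 + θ i + g i ≡ 154 * a i + θ (suc i)) →
            ∀ n → 56 * n + sumTo n g + θ 0 ≡ 154 * sumTo n a + θ n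
telescope a g θ step zero    = refl
telescope a g θ step (suc n) = begin
  56 * suc n + (sumTo n g + g n) + θ 0     ≡⟨ lhs n (sumTo n g) (g n) (θ 0) ⟩
  56 * n + sumTo n g + θ 0 + (56 + g n)    ≡⟨ cong (_+ (56 + g n)) (telescope a g θ step n) ⟩
  154 * sumTo n a + θ n + (56 + g n)       ≡⟨ mid (sumTo n a) (θ n) (g n) ⟩
  154 * sumTo n a + (56 + θ n + g n)       ≡⟨ cong (154 * sumTo n a +_) (step n) ⟩
  154 * sumTo n a + (154 * a n + θ (suc n)) ≡⟨ rhs (sumTo n a) (a n) (θ (suc n)) ⟩
  154 * (sumTo n a + a n) + θ (suc n)      ∎
  where
  open ≡-Reasoning
  lhs : ∀ n s g t → 56 * suc n + (s + g) + t ≡ 56 * n + s + t + (56 + g)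
  lhs = solve-∀
  mid : ∀ s t g → 154 * s + t + (56 + g) ≡ 154 * s + (56 + t + g)
  mid = solve-∀
  rhs : ∀ s a t → 154 * s + (154 * a + t) ≡ 154 * (s + a) + t
  rhs = solve-∀

Slack : Bool → Bool → ℕ → Set
Slack true  true  e = e ≡ 0
Slack true  false e = 43 ≤ e
Slack false _     e = 1 ≤ e

slackOK⇒Slack : ∀ a b p c → T (slackOK a b p c) → ∃ λ e → p + e ≡ c × Slack a b e
slackOK⇒Slack true  true  p c ok = 0 , trans (+-identityʳ p) (≡ᵇ⇒≡ p c ok) , refl
slackOK⇒Slack true  false p c ok =
  let p+43≤c = ≤ᵇ⇒≤ (p + 43) c ok
  in c ∸ p , m+[n∸m]≡n (m+n≤o⇒m≤o p p+43≤c) , m+n≤o⇒m≤o∸n 43 (subst (_≤ c) (+-comm p 43) p+43≤c)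
slackOK⇒Slack false b     p c ok =
  let p+1≤c = ≤ᵇ⇒≤ (p + 1) c ok
  in c ∸ p , m+[n∸m]≡n (m+n≤o⇒m≤o p p+1≤c) , m+n≤o⇒m≤o∸n 1 (subst (_≤ c) (+-comm p 1) p+1≤c)

module Walk (z : ℕ → Bool) (g : ℕ → ℕ) (slack : ∀ i → Slack (z i) (z (suc i)) (g i)) where

  -- The Boolean indices tell whether the walk starts and ends on the cycle. `enters` carries no
  -- bound: such a walk is not closed, and to close it must leave the cycle again, which pays the
  -- 43.
  data Outcome (n : ℕ) : Bool → Bool → Set where
    leaves : ∀ {a b} → 43 ≤ sumTo n g → Outcome n a b
    stays  : sumTo n g ≡ 0 → Outcome n true true
    avoids : n ≤ sumTo n g → Outcome n false false
    enters : Outcome n false true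

  outcome : ∀ n → Outcome n (z 0) (z n)
  outcome zero with z 0
  ... | true  = stays refl
  ... | false = avoids z≤n
  outcome (suc n) = extend (outcome n) (slack n)
    where
    extend : ∀ {a b c} → Outcome n a b → Slack b c (g n) → Outcome (suc n) a c
    extend             (leaves h) _ = leaves (≤-trans h (m≤m+n _ _))
    extend {c = true}  (stays h)  e = stays (cong₂ _+_ h e)
    extend {c = false} (stays h)  e = leaves (≤-trans e (m≤n+m _ _))
    extend {c = true}  (avoids h) e = enters
    extend {c = false} (avoids h) e = avoids (subst (_≤ sumTo (suc n) g) (+-comm n 1) (+-mono-≤ h e))
    extend {c = true}  enters     e = enters
    extend {c = false} enters     e = leaves (≤-trans e (m≤n+m _ _))

  closed : ∀ n → z n ≡ z 0 → sumTo n g ≡ 0 ⊎ 43 ≤ sumTo n g ⊎ n ≤ sumTo n g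
  closed n zn≡z0 = cases (outcome n) zn≡z0
    where
    cases : ∀ {a b} → Outcome n a b → b ≡ a → _
    cases (leaves h) _ = inj₂ (inj₁ h)
    cases (stays h)  _ = inj₁ h
    cases (avoids h) _ = inj₂ (inj₂ h)

-- Here `e` is the sum of the step costs. Periodicity of the lifted code makes the last state equal
-- to the first, so the potential drops out and `e` is 14 (11 |C| - 4 n).
excess : ∀ n .{{_ : NonZero n}} → 11 ≤ n → (C : Subset n) → IsIdentifying n C →
         ∃ λ e → 56 * n + e ≡ 154 * ∣ C ∣ × (e ≡ 0 ⊎ 43 ≤ e ⊎ n ≤ e)
excess n 11≤n C identifying = sumTo n slack , total , Walk.closed z slack (proj₂ ∘ proj₂ ∘ step) n (cong onCycle closes)
  where
  open Cyclic n
  open Necessary 11≤n C identifying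
  open ≡-Reasoning

  x = lift C
  θ = proj₁ certificate

  state : ℕ → Vec Bool 12
  state i = window 12 (λ j → x (i + j))

  z = onCycle ∘ state

  Step : Vec Bool 12 → Bool → Vec Bool 12 → Set
  Step s b t = ∃ λ e → 56 + θ s + e ≡ 154 * bit b + θ t × Slack (onCycle s) (onCycle t) e

  step-word : ∀ w → T (valid w) → Step (front w) (Vec.head w) (Vec.tail w)
  step-word w v = slackOK⇒Slack (onCycle (front w)) (onCycle (Vec.tail w))
    (56 + θ (front w)) (154 * bit (Vec.head w) + θ (Vec.tail w)) (proj₂ certificate w v)

  transport : ∀ {s s′ b b′ t t′} → s ≡ s′ → b ≡ b′ → t ≡ t′ → Step s b t → Step s′ b′ t′
  transport refl refl refl st = st

  step : ∀ i → Step (state i) (x i) (state (suc i))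
  step i = transport (front-window 12 y) (cong x (+-identityʳ i))
             (window-cong 12 {y ∘ suc} {λ j → x (suc i + j)} (λ j _ → cong x (+-suc i j)))
             (step-word (window 13 y) (ValidAt.isValid (valid-windows i)))
    where
    y : ℕ → Bool
    y j = x (i + j)

  slack = proj₁ ∘ step

  closes : state n ≡ state 0
  closes = window-cong 12 (λ j _ → lift-+n C j)

  size : ∣ C ∣ ≡ sumTo n (bit ∘ x)
  size = ∣∣≡sumTo C x (λ i → cong (Vec.lookup C) (mod-≡ (toℕ i) i refl))

  total : 56 * n + sumTo n slack ≡ 154 * ∣ C ∣
  total = +-cancelʳ-≡ (θ (state 0)) _ _ (begin
    56 * n + sumTo n slack + θ (state 0)      ≡⟨ telescope (bit ∘ x) slack (θ ∘ state) (proj₁ ∘ proj₂ ∘ step) n ⟩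
    154 * sumTo n (bit ∘ x) + θ (state n)     ≡⟨ cong₂ (λ m w → 154 * m + θ w) (sym size) closes ⟩
    154 * ∣ C ∣ + θ (state 0)                 ∎)

-- Upper bound: codes from cyclic words.

ValidAt-cong : ∀ {x y s t} → (∀ i → i < 13 → x (s + i) ≡ y (t + i)) → ValidAt x s → ValidAt y t
ValidAt-cong x≗y (validAt v) = validAt (subst (λ w → T (valid w)) (window-cong 13 x≗y) v)

allValid : ℕ → List Bool → Bool
allValid zero    l = true
allValid (suc m) l = valid (window 13 (nth l)) ∧ allValid m (drop 1 l)

nth-drop : ∀ l i → nth (drop 1 l) i ≡ nth l (suc i)
nth-drop []      i = refl
nth-drop (b ∷ l) i = refl

allValid⁻ : ∀ m l → T (allValid m l) → ∀ s → s < m → ValidAt (nth l) s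
allValid⁻ (suc m) l t zero    _   = validAt (proj₁ (to T-∧ t))
allValid⁻ (suc m) l t (suc s) s<m =
  ValidAt-cong {nth (drop 1 l)} {nth l} {s} {suc s} (λ i _ → nth-drop l (s + i))
    (allValid⁻ m (drop 1 l) (proj₂ (to (T-∧ {valid (window 13 (nth l))}) t)) s (s<s⁻¹ s<m))

nth-++ˡ : ∀ l {l′} i → i < length l → nth (l ++ l′) i ≡ nth l i
nth-++ˡ (b ∷ l) zero    _   = refl
nth-++ˡ (b ∷ l) (suc i) i<n = nth-++ˡ l i (s<s⁻¹ i<n)

nth-++ʳ : ∀ l {l′} i → nth (l ++ l′) (length l + i) ≡ nth l′ i
nth-++ʳ []      i = refl
nth-++ʳ (b ∷ l) i = nth-++ʳ l i

nth-take : ∀ m l i → i < m → nth (take m l) i ≡ nth l i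
nth-take (suc m) []      i       _   = refl
nth-take (suc m) (b ∷ l) zero    _   = refl
nth-take (suc m) (b ∷ l) (suc i) i<m = nth-take m l i (s<s⁻¹ i<m)

lookup-fromList : ∀ l i → Vec.lookup (fromList l) i ≡ nth l (toℕ i)
lookup-fromList (b ∷ l) Fin.zero    = refl
lookup-fromList (b ∷ l) (Fin.suc i) = lookup-fromList l i

weight : List Bool → ℕ
weight []      = 0
weight (b ∷ l) = bit b + weight l

∣fromList∣ : ∀ l → ∣ fromList l ∣ ≡ weight l
∣fromList∣ []          = refl
∣fromList∣ (true  ∷ l) = cong suc (∣fromList∣ l)
∣fromList∣ (false ∷ l) = ∣fromList∣ l

Code : (n : ℕ) → .{{NonZero n}} → ℕ → Set
Code n m = Σ (Subset n) λ C → IsIdentifying n C × ∣ C ∣ ≡ m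

-- Repeating the first 12 letters at the end lets all `n` windows of length 13 be read without
-- wrapping, and none of them reaches the padding of `nth`.
cyclicCode : ∀ l {n} .{{_ : NonZero n}} → length l ≡ n → 13 ≤ n →
             T (allValid n (l ++ take 12 l)) → Code n (weight l)
cyclicCode l {n} refl 13≤n ok = C , Sufficient.identifying 13≤n C valid-windows , ∣fromList∣ l
  where
  open Cyclic n
  C = fromList l

  unroll : ∀ j → j < n + 12 → nth (l ++ take 12 l) j ≡ nth l (j % n)
  unroll j j<n+12 with j <? n
  ... | yes j<n = trans (nth-++ˡ l j j<n) (cong (nth l) (sym (m<n⇒m%n≡m j<n)))
  ... | no j≮n with m≤n⇒∃[o]m+o≡n (≮⇒≥ j≮n)
  ...   | i , refl = trans (nth-++ʳ l i) (trans (nth-take 12 l i i<12) (cong (nth l) (sym (begin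
    (n + i) % n ≡⟨ cong (_% n) (+-comm n i) ⟩
    (i + n) % n ≡⟨ [m+n]%n≡m%n i n ⟩
    i % n       ≡⟨ m<n⇒m%n≡m (≤-trans i<12 (≤-trans (n≤1+n 12) 13≤n)) ⟩
    i           ∎))))
    where
    open ≡-Reasoning
    i<12 = +-cancelˡ-< n i 12 j<n+12

  lift-C : ∀ i → lift C i ≡ nth l (i % n)
  lift-C i = trans (lookup-fromList l (i mod n)) (cong (nth l) (toℕ-fromℕ< (m%n<n i n)))

  valid-windows : ∀ s → ValidAt (lift C) s
  valid-windows s = ValidAt-cong {nth (l ++ take 12 l)} {lift C} {s % n} {s} agree
    (allValid⁻ n (l ++ take 12 l) ok (s % n) (m%n<n s n))
    where
    open ≡-Reasoning
    agree : ∀ i → i < 13 → nth (l ++ take 12 l) (s % n + i) ≡ lift C (s + i)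
    agree i i<13 = begin
      nth (l ++ take 12 l) (s % n + i) ≡⟨ unroll (s % n + i) (+-mono-<-≤ (m%n<n s n) (s≤s⁻¹ i<13)) ⟩
      nth l ((s % n + i) % n)          ≡⟨ cong (nth l) (≋-+ʳ i (m%n%n≡m%n s n)) ⟩
      nth l ((s + i) % n)              ≡⟨ lift-C (s + i) ⟨
      lift C (s + i)                   ∎

-- For n = 11 and n = 12 the offsets 0, …, 12 are not distinct modulo n, so the
-- window criterion does not apply and identification is decided directly.
identifying? : ∀ n .{{_ : NonZero n}} C → Dec (IsIdentifying n C)
identifying? n C = all? (λ u → nonempty? (I C u)) ×-dec
  all? (λ u → all? λ v → ¬? (u Fin.≟ v) →-dec ¬? (≡-dec Bool._≟_ (I C u) (I C v)))

checkedCode : ∀ n .{{_ : NonZero n}} (C : Subset n) → True (identifying? n C) → Code n ∣ C ∣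
checkedCode n C ok = C , toWitness ok , refl

repeat : ℕ → List Bool → List Bool
repeat zero    l = l
repeat (suc q) l = period ++ repeat q l

length-repeat : ∀ q l → length (repeat q l) ≡ q * 11 + length l
length-repeat zero    l = refl
length-repeat (suc q) l = cong (11 +_) (length-repeat q l)

weight-repeat : ∀ q l → weight (repeat q l) ≡ q * 4 + weight l
weight-repeat zero    l = refl
weight-repeat (suc q) l = cong (4 +_) (weight-repeat q l)

repeat-++ : ∀ q l l′ → repeat q l ++ l′ ≡ repeat q (l ++ l′)
repeat-++ zero    l l′ = refl
repeat-++ (suc q) l l′ = cong (period ++_) (repeat-++ q l l′)

-- Both `period` and the appended word begin with `■`, so the 23 letters seen from a new leading
-- period are always the same, and these eleven windows are checked by evaluation. The case split on
-- `q` only exposes that last `■`.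
allValid-repeat : ∀ q m l → T (allValid (11 + m) (period ++ ■ ∷ l)) →
                  T (allValid (suc q * 11 + m) (repeat (suc q) (■ ∷ l)))
allValid-repeat zero    m l ok = ok
allValid-repeat (suc q) m l ok = extend q (allValid-repeat q m l ok)
  where
  -- Windows starting in the first of two consecutive periods read at most one letter beyond them.
  extend : ∀ q → T (allValid (suc q * 11 + m) (repeat (suc q) (■ ∷ l))) →
           T (allValid (suc (suc q) * 11 + m) (repeat (suc (suc q)) (■ ∷ l)))
  extend zero    ok = ok
  extend (suc q) ok = ok

startsRepeat : ∀ q l → take 12 (repeat (suc q) (■ ∷ l)) ≡ period ++ ■ ∷ []
startsRepeat zero    l = refl
startsRepeat (suc q) l = refl

-- A single evaluation, with one period before the appended word and the wrapped letters after it,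
-- certifies the codes for every `q`.
periodicCode : ∀ q l {n} .{{_ : NonZero n}} → suc q * 11 + suc (length l) ≡ n → 13 ≤ n →
               T (allValid (12 + length l) (period ++ ■ ∷ l ++ period ++ ■ ∷ [])) →
               Code n (suc q * 4 + suc (weight l))
periodicCode q l {n} len 13≤n ok =
  subst (λ m → Code n m) (weight-repeat (suc q) (■ ∷ l))
    (cyclicCode w (trans (length-repeat (suc q) (■ ∷ l)) len) 13≤n (subst (λ m → T (allValid m (w ++ take 12 w))) len
      (subst (λ v → T (allValid (suc q * 11 + suc (length l)) v)) unfold
        (allValid-repeat q (suc (length l)) (l ++ period ++ ■ ∷ []) ok))))
  where
  w = repeat (suc q) (■ ∷ l)
  unfold : repeat (suc q) (■ ∷ l ++ period ++ ■ ∷ []) ≡ w ++ take 12 w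
  unfold = trans (sym (repeat-++ (suc q) (■ ∷ l) (period ++ ■ ∷ []))) (cong (w ++_) (sym (startsRepeat q l)))

-- The ceiling bound and when it is not attained.

ceil-+ : ∀ r q → ceil4n/11 (r + q * 11) ≡ ceil4n/11 r + q * 4
ceil-+ r q = begin
  (4 * (r + q * 11) + 10) / 11              ≡⟨ cong (_/ 11) (regroup r q) ⟩
  (4 * r + 10 + q * 4 * 11) / 11            ≡⟨ +-distrib-/-∣ʳ (4 * r + 10) {q * 4 * 11} {11} (n∣m*n (q * 4)) ⟩
  (4 * r + 10) / 11 + q * 4 * 11 / 11       ≡⟨ cong ((4 * r + 10) / 11 +_) (m*n/n≡m (q * 4) 11) ⟩
  (4 * r + 10) / 11 + q * 4                 ∎
  where
  open ≡-Reasoning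
  regroup : ∀ r q → 4 * (r + q * 11) + 10 ≡ 4 * r + 10 + q * 4 * 11
  regroup = solve-∀

ceil-lower : ∀ n .{{_ : NonZero n}} → 11 ≤ n → ∀ C → IsIdentifying n C → ceil4n/11 n ≤ ∣ C ∣
ceil-lower n 11≤n C identifying = begin
  (4 * n + 10) / 11         ≤⟨ /-monoˡ-≤ 11 (+-monoˡ-≤ 10 4n≤11m) ⟩
  (11 * ∣ C ∣ + 10) / 11    ≡⟨ cong (_/ 11) (trans (+-comm (11 * ∣ C ∣) 10) (cong (10 +_) (*-comm 11 ∣ C ∣))) ⟩
  (10 + ∣ C ∣ * 11) / 11    ≡⟨ +-distrib-/-∣ʳ 10 {∣ C ∣ * 11} {11} (n∣m*n ∣ C ∣) ⟩
  ∣ C ∣ * 11 / 11           ≡⟨ m*n/n≡m ∣ C ∣ 11 ⟩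
  ∣ C ∣                     ∎
  where
  open ≤-Reasoning
  4n≤11m : 4 * n ≤ 11 * ∣ C ∣
  4n≤11m = let e , total , _ = excess n 11≤n C identifying in *-cancelˡ-≤ 14 (begin
    14 * (4 * n)      ≡⟨ *-assoc 14 4 n ⟨
    56 * n            ≤⟨ m≤m+n (56 * n) e ⟩
    56 * n + e        ≡⟨ total ⟩
    154 * ∣ C ∣       ≡⟨ *-assoc 14 11 ∣ C ∣ ⟩
    14 * (11 * ∣ C ∣) ∎)

excess≡14c : ∀ r q m c e → 11 * m ≡ 4 * r + c → 56 * (r + q * 11) + e ≡ 154 * (m + q * 4) → e ≡ 14 * c
excess≡14c r q m c e 11m≡4r+c total = +-cancelˡ-≡ (56 * (r + q * 11)) e (14 * c) (begin
  56 * (r + q * 11) + e        ≡⟨ total ⟩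
  154 * (m + q * 4)            ≡⟨ factor m q ⟩
  14 * (11 * m + q * 44)       ≡⟨ cong (λ s → 14 * (s + q * 44)) 11m≡4r+c ⟩
  14 * (4 * r + c + q * 44)    ≡⟨ rearrange r q c ⟩
  56 * (r + q * 11) + 14 * c   ∎)
  where
  open ≡-Reasoning
  factor : ∀ m q → 154 * (m + q * 4) ≡ 14 * (11 * m + q * 44)
  factor = solve-∀
  rearrange : ∀ r q c → 14 * (4 * r + c + q * 44) ≡ 56 * (r + q * 11) + 14 * c
  rearrange = solve-∀

-- A code of size ⌈4n/11⌉ would have excess `14 * c`. This is positive, at most 42 and below `n`,
-- against all three alternatives of `excess`.
ceil+1-lower : ∀ r q c .{{_ : NonZero (r + q * 11)}} → 11 ≤ r + q * 11 →
  11 * ceil4n/11 r ≡ 4 * r + c → 1 ≤ c → c ≤ 3 → 14 * c < r + q * 11 →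
  ∀ C → IsIdentifying (r + q * 11) C → ceil4n/11 (r + q * 11) + 1 ≤ ∣ C ∣
ceil+1-lower r q c 11≤n 11m≡4r+c 1≤c c≤3 14c<n C identifying =
  subst (_≤ ∣ C ∣) (+-comm 1 _) (≤∧≢⇒< (ceil-lower n 11≤n C identifying) (λ m≡ → tight (sym (trans (sym (ceil-+ r q)) m≡))))
  where
  n = r + q * 11
  tight : ∣ C ∣ ≢ ceil4n/11 r + q * 4
  tight m≡ = refute (proj₂ (proj₂ ex))
    where
    ex = excess n 11≤n C identifying
    e = proj₁ ex
    e≡14c : e ≡ 14 * c
    e≡14c = excess≡14c r q (ceil4n/11 r) c e 11m≡4r+c (trans (proj₁ (proj₂ ex)) (cong (154 *_) m≡))
    refute : e ≡ 0 ⊎ 43 ≤ e ⊎ n ≤ e → ⊥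
    refute (inj₁ e≡0)         = <⇒≢ (≤-trans z<s (*-monoʳ-≤ 14 1≤c)) (trans (sym e≡0) e≡14c)
    refute (inj₂ (inj₁ 43≤e)) = <⇒≱ (s≤s (*-monoʳ-≤ 14 c≤3)) (subst (43 ≤_) e≡14c 43≤e)
    refute (inj₂ (inj₂ n≤e))  = <⇒≱ 14c<n (subst (n ≤_) e≡14c n≤e)

-- Exact values by residue modulo 11.

11≤r+11q : ∀ r k → 11 ≤ r + suc k * 11
11≤r+11q r k = ≤-trans (m≤m+n 11 (k * 11)) (m≤n+m (suc k * 11) r)

γ-ceil : ∀ r k {m} .{{_ : NonZero (r + suc k * 11)}} → ceil4n/11 (r + suc k * 11) ≡ m →
         Code (r + suc k * 11) m → γID≡ (r + suc k * 11) (ceil4n/11 (r + suc k * 11))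
γ-ceil r k eq code = subst (λ m → Code (r + suc k * 11) m) (sym eq) code , ceil-lower _ (11≤r+11q r k)

periodic : ∀ k l v .{{_ : NonZero (suc (length l) + suc k * 11)}} → 13 ≤ suc (length l) + suc k * 11 →
           T (allValid (12 + length l) (period ++ ■ ∷ l ++ period ++ ■ ∷ [])) → suc (weight l) ≡ v →
           Code (suc (length l) + suc k * 11) (v + suc k * 4)
periodic k l v 13≤n ok refl = subst (λ m → Code (suc (length l) + suc k * 11) m) (+-comm (suc k * 4) v)
  (periodicCode k l (+-comm (suc k * 11) (suc (length l))) 13≤n ok)

γ-periodic : ∀ k l .{{_ : NonZero (suc (length l) + suc k * 11)}} → 13 ≤ suc (length l) + suc k * 11 →
           T (allValid (12 + length l) (period ++ ■ ∷ l ++ period ++ ■ ∷ [])) →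
           suc (weight l) ≡ ceil4n/11 (suc (length l)) →
           γID≡ (suc (length l) + suc k * 11) (ceil4n/11 (suc (length l) + suc k * 11))
γ-periodic k l 13≤n ok eq = γ-ceil (suc (length l)) k (ceil-+ (suc (length l)) (suc k)) (periodic k l _ 13≤n ok eq)

-- For nonzero `r` the appended word has `r` letters, counting the leading `■`, and weight ⌈4r/11⌉;
-- each period adds 11 letters of weight 4.
γ-general : ∀ r k .{{_ : NonZero (r + suc k * 11)}} → r < 11 → ¬ (r ≡ 2 ⊎ r ≡ 5 ⊎ r ≡ 8) →
            γID≡ (r + suc k * 11) (ceil4n/11 (r + suc k * 11))
γ-general 0  zero    _ _ = γ-ceil 0 0 refl (checkedCode 11 (fromList period) tt)
-- An appended word cannot be empty, so residue 0 appends one whole period, whose first `■` is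
-- already supplied.
γ-general 0  (suc k) _ _ = γ-ceil 0 (suc k) (ceil-+ 0 (suc (suc k))) (periodic k (drop 1 period) 4 (m≤m+n 13 _) tt refl)
γ-general 1  zero    _ _ = γ-ceil 1 0 refl (checkedCode 12 (fromList (period ++ ■ ∷ [])) tt)
γ-general 1  (suc k) _ _ = γ-periodic (suc k) [] (m≤m+n 13 _) tt refl
γ-general 2  k _ ¬r = contradiction (inj₁ refl) ¬r
γ-general 3  k _ _ = γ-periodic k (■ ∷ □ ∷ []) (m≤m+n 13 _) tt refl
γ-general 4  k _ _ = γ-periodic k (■ ∷ □ ∷ □ ∷ []) (m≤m+n 13 _) tt refl
γ-general 5  k _ ¬r = contradiction (inj₂ (inj₁ refl)) ¬r
γ-general 6  k _ _ = γ-periodic k (■ ∷ ■ ∷ □ ∷ □ ∷ □ ∷ []) (m≤m+n 13 _) tt refl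
γ-general 7  k _ _ = γ-periodic k (■ ∷ □ ∷ ■ ∷ □ ∷ □ ∷ □ ∷ []) (m≤m+n 13 _) tt refl
γ-general 8  k _ ¬r = contradiction (inj₂ (inj₂ refl)) ¬r
γ-general 9  k _ _ = γ-periodic k (■ ∷ ■ ∷ ■ ∷ □ ∷ □ ∷ □ ∷ □ ∷ □ ∷ []) (m≤m+n 13 _) tt refl
γ-general 10 k _ _ = γ-periodic k (■ ∷ □ ∷ ■ ∷ ■ ∷ □ ∷ □ ∷ □ ∷ □ ∷ □ ∷ []) (m≤m+n 13 _) tt refl
γ-general (suc (suc (suc (suc (suc (suc (suc (suc (suc (suc (suc r))))))))))) k r<11 _ =
  contradiction r<11 (m+n≮m 11 r)

-- Only n = 13, 24, 35 and n = 16, 27 occur. A code of size ⌈4n/11⌉ has excess 42 or 28 there, so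
-- its walk must avoid the cycle, which `n ≤ 14 * c` permits; hence explicit words not built from
-- `period`.
γ-short : ∀ r k .{{_ : NonZero (r + suc k * 11)}} → r ≡ 2 ⊎ r ≡ 5 → r + suc k * 11 ≤ 37 →
          γID≡ (r + suc k * 11) (ceil4n/11 (r + suc k * 11))
γ-short r 0 (inj₁ refl) _ = γ-ceil 2 0 refl (cyclicCode (■ ∷ ■ ∷ □ ∷ □ ∷ ■ ∷ □ ∷ □ ∷ ■ ∷ ■ ∷ □ ∷ □ ∷ □ ∷ □ ∷ [])
  refl (m≤m+n 13 _) tt)
γ-short r 1 (inj₁ refl) _ = γ-ceil 2 1 refl (cyclicCode (■ ∷ ■ ∷ ■ ∷ □ ∷ □ ∷ □ ∷ ■ ∷ □ ∷ □ ∷ ■ ∷ ■ ∷ □ ∷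
  □ ∷ □ ∷ □ ∷ ■ ∷ ■ ∷ □ ∷ □ ∷ ■ ∷ □ ∷ □ ∷ □ ∷ □ ∷ []) refl (m≤m+n 13 _) tt)
γ-short r 2 (inj₁ refl) _ = γ-ceil 2 2 refl (cyclicCode (■ ∷ ■ ∷ ■ ∷ □ ∷ □ ∷ □ ∷ ■ ∷ □ ∷ □ ∷ □ ∷ ■ ∷ ■ ∷
  ■ ∷ □ ∷ □ ∷ □ ∷ □ ∷ ■ ∷ □ ∷ □ ∷ ■ ∷ ■ ∷ □ ∷ □ ∷ □ ∷ □ ∷ ■ ∷ ■ ∷ □ ∷ □ ∷ ■ ∷ □ ∷ □ ∷ □ ∷ □ ∷ []) refl (m≤m+n 13 _) tt)
γ-short r (suc (suc (suc k))) (inj₁ refl) n≤37 = contradiction (≤-trans (m≤m+n 38 _) n≤37) (n≮n 37)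
γ-short r 0 (inj₂ refl) _ = γ-ceil 5 0 refl (cyclicCode (■ ∷ ■ ∷ □ ∷ □ ∷ ■ ∷ □ ∷ □ ∷ ■ ∷ □ ∷ □ ∷ ■ ∷ ■ ∷
  □ ∷ □ ∷ □ ∷ □ ∷ []) refl (m≤m+n 13 _) tt)
γ-short r 1 (inj₂ refl) _ = γ-ceil 5 1 refl (cyclicCode (■ ∷ ■ ∷ ■ ∷ □ ∷ □ ∷ □ ∷ ■ ∷ □ ∷ □ ∷ ■ ∷ □ ∷ □ ∷
  ■ ∷ ■ ∷ □ ∷ □ ∷ □ ∷ □ ∷ ■ ∷ ■ ∷ □ ∷ □ ∷ ■ ∷ □ ∷ □ ∷ □ ∷ □ ∷ []) refl (m≤m+n 13 _) tt)
γ-short r (suc (suc k)) (inj₂ refl) n≤37 = contradiction (≤-trans (m≤m+n 38 _) n≤37) (n≮n 37)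

-- The values 11⌈4r/11⌉ - 4r for `r` = 8, 2, 5 are `c` = 1, 3, 2, so the lower bound needs `n` above
-- 14, 42, 28 respectively.
γ-extra : ∀ r k .{{_ : NonZero (r + suc k * 11)}} → r ≡ 8 ⊎ (r ≡ 2 ⊎ r ≡ 5) × 38 ≤ r + suc k * 11 →
          γID≡ (r + suc k * 11) (ceil4n/11 (r + suc k * 11) + 1)
γ-extra r k = byResidue
  where
  appended : ∀ l c → let r = suc (length l) in .{{_ : NonZero (r + suc k * 11)}} → 13 ≤ r + suc k * 11 →
     T (allValid (11 + r) (period ++ ■ ∷ l ++ period ++ ■ ∷ [])) →
     suc (weight l) ≡ ceil4n/11 r + 1 → 11 * ceil4n/11 r ≡ 4 * r + c → 1 ≤ c → c ≤ 3 → 14 * c < r + suc k * 11 →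
     γID≡ (r + suc k * 11) (ceil4n/11 (r + suc k * 11) + 1)
  appended l c 13≤n ok w eq 1≤c c≤3 14c<n =
    subst (λ m → Code (suc (length l) + suc k * 11) m) shuffle (periodic k l _ 13≤n ok w)
    , ceil+1-lower (suc (length l)) (suc k) c (11≤r+11q (suc (length l)) k) eq 1≤c c≤3 14c<n
    where
    m = ceil4n/11 (suc (length l))
    shuffle : m + 1 + suc k * 4 ≡ ceil4n/11 (suc (length l) + suc k * 11) + 1
    shuffle = trans (trans (+-assoc m 1 _) (trans (cong (m +_) (+-comm 1 (suc k * 4))) (sym (+-assoc m _ 1))))
      (cong (_+ 1) (sym (ceil-+ (suc (length l)) (suc k))))

  -- The residue closes the gap between 38 and 43: after 35 the next order with residue 2 is 46.
  long : ∀ k → 38 ≤ 2 + suc k * 11 → 42 < 2 + suc k * 11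
  long 0 h = contradiction h (<⇒≱ (m≤m+n 14 24))
  long 1 h = contradiction h (<⇒≱ (m≤m+n 25 13))
  long 2 h = contradiction h (<⇒≱ (m≤m+n 36 2))
  long (suc (suc (suc k))) _ = m≤m+n 43 _

  byResidue : r ≡ 8 ⊎ (r ≡ 2 ⊎ r ≡ 5) × 38 ≤ r + suc k * 11 → γID≡ (r + suc k * 11) (ceil4n/11 (r + suc k * 11) + 1)
  byResidue (inj₁ refl) = appended (■ ∷ ■ ∷ ■ ∷ □ ∷ □ ∷ □ ∷ □ ∷ []) 1 (m≤m+n 13 _) tt refl refl (m≤m+n 1 0) (m≤m+n 1 2) (m≤m+n 15 _)
  byResidue (inj₂ (inj₁ refl , 38≤n)) = appended (■ ∷ []) 3 (m≤m+n 13 _) tt refl refl (m≤m+n 1 2) ≤-refl (long k 38≤n)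
  byResidue (inj₂ (inj₂ refl , 38≤n)) = appended (■ ∷ ■ ∷ □ ∷ □ ∷ []) 2 (m≤m+n 13 _) tt refl refl (m≤m+n 1 1) (m≤m+n 2 1) (≤-trans (m≤m+n 29 9) 38≤n)

-- The quotient has the form `suc k` because the periodic constructions start from at least one
-- `period`.
data Split : ℕ → Set where
  split : ∀ r k → r < 11 → Split (r + suc k * 11)

splitting : ∀ n → 11 ≤ n → Split n
splitting n 11≤n with n / 11 | m≥n⇒m/n>0 {n} {11} 11≤n | m≡m%n+[m/n]*n n 11
... | suc k | _ | eq = subst Split (sym eq) (split (n % 11) k (m%n<n n 11))

theorem6 : (n : ℕ) → .{{_ : NonZero n}} → 11 ≤ n →
    (n ≤ 37 →
    (n % 11 ≡ 8 → γID≡ n (ceil4n/11 n + 1)) ×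
    (¬ (n % 11 ≡ 8) → γID≡ n (ceil4n/11 n))) ×
    (38 ≤ n →
    ((n % 11 ≡ 2 ⊎ n % 11 ≡ 5 ⊎ n % 11 ≡ 8) → γID≡ n (ceil4n/11 n + 1)) ×
    (¬ (n % 11 ≡ 2 ⊎ n % 11 ≡ 5 ⊎ n % 11 ≡ 8) → γID≡ n (ceil4n/11 n)))
theorem6 n 11≤n with splitting n 11≤n
... | split r k r<11 rewrite trans ([m+kn]%n≡m%n r (suc k) 11) (m<n⇒m%n≡m r<11) =
  (λ n≤37 → (λ r≡8 → γ-extra r k (inj₁ r≡8)) , short n≤37) ,
  (λ 38≤n → (λ r≡ → γ-extra r k (long 38≤n r≡)) , γ-general r k r<11)
  where
  long : 38 ≤ r + suc k * 11 → r ≡ 2 ⊎ r ≡ 5 ⊎ r ≡ 8 → r ≡ 8 ⊎ (r ≡ 2 ⊎ r ≡ 5) × 38 ≤ r + suc k * 11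
  long 38≤n (inj₁ r≡2)        = inj₂ (inj₁ r≡2 , 38≤n)
  long 38≤n (inj₂ (inj₁ r≡5)) = inj₂ (inj₂ r≡5 , 38≤n)
  long 38≤n (inj₂ (inj₂ r≡8)) = inj₁ r≡8
  short : r + suc k * 11 ≤ 37 → ¬ (r ≡ 8) → γID≡ (r + suc k * 11) (ceil4n/11 (r + suc k * 11))
  short n≤37 r≢8 with (r ≟ 2) ⊎-dec (r ≟ 5)
  ... | yes r≡ = γ-short r k r≡ n≤37
  ... | no ¬r≡ = γ-general r k r<11 λ where
    (inj₁ r≡2)        → ¬r≡ (inj₁ r≡2)
    (inj₂ (inj₁ r≡5)) → ¬r≡ (inj₂ r≡5)
    (inj₂ (inj₂ r≡8)) → r≢8 r≡8
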